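{- If $G$ is a connected graph of order at least $3$, then $\chi'_g(G)\leq 2(\Delta(G)+{\rm col}(G))-5$.
   Context: ${\rm col}(G)$, the coloring number of $G$, is the least integer $k$ such that every subgraph of $G$ has minimum degree less than $k$ (equivalently, the vertices can be ordered so that each vertex has at most $k-1$ neighbors preceding it). $\Delta(G)$ is the maximum degree. For an Abelian group $\mathcal{G}$ (written additively), a $\mathcal{G}$-twin edge coloring of $G$ is a proper edge labeling $f:E(G)\to\mathcal{G}$ (adjacent edges receive distinct labels) such that the weighted degrees $w(v)=\sum_{u\in N(v)}f(uv)$ satisfy $w(u)\neq w(v)$ for every edge $uv$. The group twin chromatic index $\chi'_g(G)$ is the least integer $k\geq 2$ such that $G$ has a $\mathcal{G}$-twin edge coloring for every Abelian group $\mathcal{G}$ of order $k$. -}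

module Defs where

open import Level using (0ℓ)
open import Data.Nat using (ℕ; zero; suc; _+_; _*_; _≤_; _<_; _⊔_)
open import Data.Fin using (Fin; zero; suc)
open import Data.Bool using (Bool; true; false; if_then_else_)
open import Data.Product using (Σ; ∃; _×_; _,_)
open import Relation.Binary.PropositionalEquality using (_≡_; _≢_)
open import Relation.Binary.Construct.Closure.ReflexiveTransitive using (Star)
open import Relation.Nullary using (¬_)
open import Algebra.Bundles using (AbelianGroup)
open import Function.Bundles using (Bijection)
import Relation.Binary.PropositionalEquality as P

record Graph (n : ℕ) : Set where
  field
    adj   : Fin n → Fin n → Bool
    sym   : ∀ u v → adj u v ≡ adj v u
    irrefl : ∀ v → adj v v ≡ false

open Graph public

Adj : ∀ {n} → Graph n → Fin n → Fin n → Set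
Adj G u v = adj G u v ≡ true

countB : ∀ {n} → (Fin n → Bool) → ℕ
countB {zero}  p = 0
countB {suc n} p = (if p zero then 1 else 0) + countB (λ i → p (suc i))

maxF : ∀ {n} → (Fin n → ℕ) → ℕ
maxF {zero}  f = 0
maxF {suc n} f = f zero ⊔ maxF (λ i → f (suc i))

degree : ∀ {n} → Graph n → Fin n → ℕ
degree G v = countB (adj G v)

maxDegree : ∀ {n} → Graph n → ℕ
maxDegree G = maxF (degree G)

Connected : ∀ {n} → Graph n → Set
Connected G = ∀ u v → Star (Adj G) u v

record Subgraph {n : ℕ} (G : Graph n) : Set where
  field
    S  : Fin n → Bool
    E  : Fin n → Fin n → Bool
    E-sym : ∀ u v → E u v ≡ E v u
    E⊆G   : ∀ u v → E u v ≡ true → adj G u v ≡ true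
    E⊆S   : ∀ u v → E u v ≡ true → S u ≡ true

open Subgraph public

ColProp : ∀ {n} → Graph n → ℕ → Set
ColProp G k = (H : Subgraph G) → (∃ λ v → S H v ≡ true) →
              ∃ λ v → S H v ≡ true × countB (E H v) < k

IsColoringNumber : ∀ {n} → Graph n → ℕ → Set
IsColoringNumber G c = ColProp G c × (∀ k → ColProp G k → c ≤ k)

module _ (A : AbelianGroup 0ℓ 0ℓ) where
  open AbelianGroup A

  gsum : ∀ {n} → (Fin n → Carrier) → Carrier
  gsum {zero}  f = ε
  gsum {suc n} f = f zero ∙ gsum (λ i → f (suc i))

  HasOrder : ℕ → Set
  HasOrder k = Bijection (P.setoid (Fin k)) setoid

  weight : ∀ {n} → Graph n → (Fin n → Fin n → Carrier) → Fin n → Carrier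
  weight G f v = gsum (λ u → if adj G v u then f v u else ε)

  IsTwinColoring : ∀ {n} → Graph n → (Fin n → Fin n → Carrier) → Set
  IsTwinColoring G f =
    -- labels are well defined on (undirected) edges
    (∀ u v → Adj G u v → f u v ≈ f v u) ×
    (∀ v u u′ → Adj G v u → Adj G v u′ → u ≢ u′ → ¬ (f v u ≈ f v u′)) ×
    (∀ u v → Adj G u v → ¬ (weight G f u ≈ weight G f v))

TwinAdmissible : ∀ {n} → Graph n → ℕ → Set₁
TwinAdmissible G k = 2 ≤ k × ((A : AbelianGroup 0ℓ 0ℓ) → HasOrder A k →
                       Σ _ λ f → IsTwinColoring A G f)

-- χ'_g(G) ≤ m  (χ'_g is the least admissible k, so this says some
-- admissible k is ≤ m)
GroupTwinIndexAtMost : ∀ {n} → Graph n → ℕ → Set₁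
GroupTwinIndexAtMost G m = ∃ λ k → TwinAdmissible G k × k ≤ m

{-# OPTIONS --safe #-}
module Submission where

-- Colour the edges greedily in a fixed order. An edge g imposes its condition on the
-- weights of its two ends only on the last edge e adjacent to g: the label of g itself
-- cancels in the difference, so exactly one value is forbidden for e. Hence k labels
-- suffice if for each e the number P(e) of earlier edges adjacent to e plus the number
-- W(e) of edges g whose last adjacent edge is e is less than k. At an end v of e with
-- P_v earlier edges, W_v ≤ max(P_v, 1), since a later edge at v leaves only itself as a
-- candidate for g. Ordering the edges lexicographically along a degeneracy order gives
-- P ≤ Δ − 1 at the lower end and P ≤ col − 2 at the upper end, hence
-- P(e) + W(e) ≤ 2(Δ + col − 3) for col ≥ 3. For col = 2 the leaves are placed last,
-- which makes W at the lower end at most 1 whenever W at the upper end is nonzero; this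
-- is enough if Δ ≥ 3. What remains are paths, labelled periodically by three
-- elements, shifted so that neither the second nor the second to last edge gets ε.

open import Defs
open import Level using (0ℓ)
open import Algebra.Bundles using (AbelianGroup)
open import Data.Bool using (Bool; true; false; if_then_else_; _∧_)
import Data.Bool.Properties as Bool
open import Data.Empty using (⊥)
open import Data.Fin using (Fin; zero; suc; toℕ; fromℕ<)
import Data.Fin.Properties as Fin
open import Data.List using (List; []; _∷_; _++_; length; map; filter; tabulate; allFin; lookup)
open import Data.List.Properties using (length-++; length-map)
open import Data.List.Membership.Propositional.Properties using (∈-allFin; ∈-filter⁺)
open import Data.List.Relation.Unary.All as All using (All; []; _∷_)
open import Data.List.Relation.Unary.All.Properties using (¬Any⇒All¬; ++⁻; map⁻)
open import Data.List.Relation.Unary.Any as Any using (Any)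
open import Data.List.Relation.Unary.Any.Properties using (lookup-index)
open import Data.Nat using (ℕ; zero; suc; _+_; _*_; _∸_; _≤_; _<_; _⊓_; _⊔_; z≤n; s≤s; s≤s⁻¹; _≤?_; _<?_)
open import Data.Nat.Properties
open import Data.Nat.Tactic.RingSolver using (solve-∀)
open import Data.Product using (Σ; ∃; _×_; _,_; proj₁; proj₂)
open import Data.Sum using (_⊎_; inj₁; inj₂; [_,_]′)
open import Function using (_∘_; id; case_of_)
open import Function.Bundles using (Bijection)
open import Relation.Binary.Construct.Closure.ReflexiveTransitive using (Star; _◅_) renaming (ε to stop)
open import Relation.Binary.Definitions using (tri<; tri≈; tri>)
open import Relation.Binary.PropositionalEquality as ≡ using (_≡_; _≢_; refl; cong; cong₂; subst)
open import Relation.Nullary using (¬_; Dec; yes; no; does; contradiction)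
open import Relation.Nullary.Decidable using (dec-true; dec-false; map′; ¬?; _×-dec_; _⊎-dec_; _→-dec_)
open import Relation.Unary using (Decidable; Pred; _⊆_)

-- Counting the elements of a finite set that satisfy a decidable predicate

private
  variable
    n : ℕ
    P Q : Pred (Fin n) 0ℓ

#_ : {P : Pred (Fin n) 0ℓ} → Decidable P → ℕ
# P? = countB (λ i → does (P? i))

#-mono : (P? : Decidable P) (Q? : Decidable Q) → P ⊆ Q → # P? ≤ # Q?
#-mono {zero}  P? Q? P⊆Q = z≤n
#-mono {suc n} P? Q? P⊆Q with P? zero | Q? zero
... | yes p | yes q = s≤s (#-mono (P? ∘ suc) (Q? ∘ suc) P⊆Q)
... | yes p | no ¬q = contradiction (P⊆Q p) ¬q
... | no ¬p | yes q = m≤n⇒m≤1+n (#-mono (P? ∘ suc) (Q? ∘ suc) P⊆Q)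
... | no ¬p | no ¬q = #-mono (P? ∘ suc) (Q? ∘ suc) P⊆Q

#-mono-< : (P? : Decidable P) (Q? : Decidable Q) → P ⊆ Q →
           ∀ {i} → Q i → ¬ P i → # P? < # Q?
#-mono-< P? Q? P⊆Q {zero} q ¬p with P? zero | Q? zero
... | yes p | _     = contradiction p ¬p
... | no _  | yes _ = s≤s (#-mono (P? ∘ suc) (Q? ∘ suc) P⊆Q)
... | no _  | no ¬q = contradiction q ¬q
#-mono-< P? Q? P⊆Q {suc i} q ¬p with P? zero | Q? zero
... | yes p | yes _ = s≤s (#-mono-< (P? ∘ suc) (Q? ∘ suc) P⊆Q q ¬p)
... | yes p | no ¬q = contradiction (P⊆Q p) ¬q
... | no _  | yes _ = m≤n⇒m≤1+n (#-mono-< (P? ∘ suc) (Q? ∘ suc) P⊆Q q ¬p)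
... | no _  | no _  = #-mono-< (P? ∘ suc) (Q? ∘ suc) P⊆Q q ¬p

#-empty : (P? : Decidable P) → (∀ i → ¬ P i) → # P? ≡ 0
#-empty {zero}  P? ¬P = refl
#-empty {suc n} P? ¬P with P? zero
... | yes p = contradiction p (¬P zero)
... | no _  = #-empty (P? ∘ suc) (¬P ∘ suc)

#-subsingleton : (P? : Decidable P) → (∀ {i j} → P i → P j → i ≡ j) → # P? ≤ 1
#-subsingleton {zero}  P? irr = z≤n
#-subsingleton {suc n} P? irr with P? zero
... | yes p = s≤s (≤-reflexive (#-empty (P? ∘ suc) (λ i q → Fin.0≢1+n (irr p q))))
... | no _  = #-subsingleton (P? ∘ suc) (λ p q → Fin.suc-injective (irr p q))

#-witness : (P? : Decidable P) → 0 < # P? → ∃ P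
#-witness P? 0<# with Fin.any? P?
... | yes ∃P = ∃P
... | no ∄P  = contradiction 0<# (<-irrefl (≡.sym (#-empty P? (λ i p → ∄P (i , p)))))

#-witness-≢ : (P? : Decidable P) → 1 < # P? → ∀ a → ∃ λ i → P i × i ≢ a
#-witness-≢ {P = P} P? 1<# a with Fin.any? (λ i → P? i ×-dec ¬? (i Fin.≟ a))
... | yes ∃i = ∃i
... | no ∄i  = contradiction (#-subsingleton P? (λ p q → ≡.trans (≡a p) (≡.sym (≡a q)))) (<⇒≱ 1<#)
  where
  ≡a : ∀ {i} → P i → i ≡ a
  ≡a {i} p with i Fin.≟ a
  ... | yes i≡a = i≡a
  ... | no i≢a  = contradiction (i , p , i≢a) ∄i

_without_ : Decidable P → (a : Fin n) → Decidable (λ i → P i × i ≢ a)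
(P? without a) i = P? i ×-dec ¬? (i Fin.≟ a)

#-without : (P? : Decidable P) → ∀ {a} → P a → # (P? without a) < # P?
#-without P? {a} p = #-mono-< (P? without a) P? proj₁ p (λ q → proj₂ q refl)

#-nonempty : (P? : Decidable P) → ∀ {i} → P i → 0 < # P?
#-nonempty P? p = ≤-trans (s≤s z≤n) (#-without P? p)

#≤1⇒unique : (P? : Decidable P) → # P? ≤ 1 → ∀ {i j} → P i → P j → i ≡ j
#≤1⇒unique P? #≤1 {i} {j} p q with i Fin.≟ j
... | yes i≡j = i≡j
... | no i≢j  = contradiction #≤1
  (<⇒≱ (<-≤-trans (s≤s (#-nonempty (P? without j) (p , i≢j))) (#-without P? q)))

#≤2⇒one-of : (P? : Decidable P) → # P? ≤ 2 → ∀ {i j k} → P i → P j → P k → i ≢ j →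
             k ≡ i ⊎ k ≡ j
#≤2⇒one-of P? #≤2 {i} {j} {k} p q r i≢j with k Fin.≟ i
... | yes k≡i = inj₁ k≡i
... | no k≢i  = inj₂ (#≤1⇒unique (P? without i)
  (s≤s⁻¹ (≤-trans (#-without P? p) #≤2)) (r , k≢i) (q , i≢j ∘ ≡.sym))

#-≟-true : (p : Fin n → Bool) → # (λ i → p i Bool.≟ true) ≡ countB p
#-≟-true {zero}  p = refl
#-≟-true {suc n} p with p zero
... | true  = cong suc (#-≟-true (p ∘ suc))
... | false = #-≟-true (p ∘ suc)

length-filter-tabulate : ∀ {A : Set} {P : Pred A 0ℓ} (P? : Decidable P) (h : Fin n → A) →
                         length (filter P? (tabulate h)) ≡ # (P? ∘ h)
length-filter-tabulate {zero}  P? h = refl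
length-filter-tabulate {suc n} P? h with does (P? (h zero))
... | true  = cong suc (length-filter-tabulate P? (h ∘ suc))
... | false = length-filter-tabulate P? (h ∘ suc)

maxF-upper : (f : Fin n → ℕ) → ∀ i → f i ≤ maxF f
maxF-upper f zero    = m≤m⊔n _ _
maxF-upper f (suc i) = ≤-trans (maxF-upper (f ∘ suc) i) (m≤n⊔m _ _)

-- Sums and avoidable values in a finite abelian group

module _ (A : AbelianGroup 0ℓ 0ℓ) where
  open AbelianGroup A renaming (refl to ≈-refl; sym to ≈-sym; trans to ≈-trans)
  open import Relation.Binary.Reasoning.Setoid setoid using (begin_; step-≈-⟩; step-≈-⟨; _∎)

  gsum-cong : {F H : Fin n → Carrier} → (∀ i → F i ≈ H i) → gsum A F ≈ gsum A H
  gsum-cong {zero}  eq = ≈-refl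
  gsum-cong {suc n} eq = ∙-cong (eq zero) (gsum-cong (eq ∘ suc))

  -- By commutativity the increment `g` of a single summand moves to the end of the sum. This serves
  -- both for colouring one more edge and for adding the next edge to the weight of a path vertex.
  gsum-update : {F H : Fin n → Carrier} {g : Carrier} (a : Fin n) →
                H a ≈ F a ∙ g → (∀ i → i ≢ a → H i ≈ F i) → gsum A H ≈ gsum A F ∙ g
  gsum-update {F = F} {H} {g} zero at off = begin
    H zero ∙ gsum A (H ∘ suc)         ≈⟨ ∙-cong at (gsum-cong (λ i → off (suc i) λ ())) ⟩
    (F zero ∙ g) ∙ gsum A (F ∘ suc)   ≈⟨ assoc _ _ _ ⟩
    F zero ∙ (g ∙ gsum A (F ∘ suc))   ≈⟨ ∙-congˡ (comm _ _) ⟩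
    F zero ∙ (gsum A (F ∘ suc) ∙ g)   ≈⟨ assoc _ _ _ ⟨
    (F zero ∙ gsum A (F ∘ suc)) ∙ g   ∎
  gsum-update {F = F} {H} {g} (suc a) at off = ≈-trans
    (∙-cong (off zero λ ()) (gsum-update a at (λ i i≢a → off (suc i) (i≢a ∘ Fin.suc-injective))))
    (≈-sym (assoc _ _ _))

  gsum-ε : {F : Fin n → Carrier} → (∀ i → F i ≈ ε) → gsum A F ≈ ε
  gsum-ε {zero}  eq = ≈-refl
  gsum-ε {suc n} eq = ≈-trans (∙-cong (eq zero) (gsum-ε (eq ∘ suc))) (identityˡ ε)

  module FiniteOrder (k : ℕ) (order : HasOrder A k) where
    open Bijection order using (to; injective; strictlySurjective)

    infix 4 _≈?_

    -- The setoid equality is arbitrary; decidability is transported from `Fin k` along the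
    -- bijection.
    _≈?_ : ∀ x y → Dec (x ≈ y)
    x ≈? y with strictlySurjective x | strictlySurjective y
    ... | i , i↦x | j , j↦y =
      map′ (λ { refl → ≈-trans (≈-sym i↦x) j↦y })
           (λ x≈y → injective (≈-trans i↦x (≈-trans x≈y (≈-sym j↦y))))
           (i Fin.≟ j)

    -- If every element occurred in `xs`, two of the `k` elements would share an index by the
    -- pigeonhole principle and hence be equal, against the injectivity of `to`.
    avoid : (xs : List Carrier) → length xs < k → ∃ λ g → All (λ x → ¬ g ≈ x) xs
    avoid xs ∣xs∣<k with Fin.any? (λ i → ¬? (Any.any? (to i ≈?_) xs))
    ... | yes (i , i∉) = to i , ¬Any⇒All¬ xs i∉
    ... | no all∈      = contradiction same (<⇒≢ i<j ∘ cong toℕ)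
      where
      hit : ∀ i → Any (to i ≈_) xs
      hit i with Any.any? (to i ≈?_) xs
      ... | yes i∈ = i∈
      ... | no i∉  = contradiction (i , i∉) all∈
      collision = Fin.pigeonhole ∣xs∣<k (Any.index ∘ hit)
      i = proj₁ collision
      j = proj₁ (proj₂ collision)
      i<j = proj₁ (proj₂ (proj₂ collision))
      same : i ≡ j
      same = injective (≈-trans (lookup-index (hit i))
        (≈-trans (reflexive (cong (lookup xs) (proj₂ (proj₂ (proj₂ collision)))))
                 (≈-sym (lookup-index (hit j)))))

    values : {P : Pred (Fin n) 0ℓ} → Decidable P → (Fin n → Carrier) → List Carrier
    values P? F = map F (filter P? (allFin _))

    length-values : {P : Pred (Fin n) 0ℓ} (P? : Decidable P) (F : Fin n → Carrier) →
                    length (values P? F) ≡ # P?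
    length-values P? F = ≡.trans (length-map F (filter P? (allFin _))) (length-filter-tabulate P? id)

    values⁻ : {P : Pred (Fin n) 0ℓ} (P? : Decidable P) {F : Fin n → Carrier} {R : Pred Carrier 0ℓ} →
              All R (values P? F) → ∀ i → P i → R (F i)
    values⁻ P? all i p = All.lookup (map⁻ all) (∈-filter⁺ P? (∈-allFin i) p)

-- Adjacency and degrees

module Adjacency {n : ℕ} (G : Graph n) where

  adj? : ∀ u v → Dec (Adj G u v)
  adj? u v = adj G u v Bool.≟ true

  Adj-sym : ∀ {u v} → Adj G u v → Adj G v u
  Adj-sym {u} {v} uv = ≡.trans (sym G v u) uv

  Adj⇒≢ : ∀ {u v} → Adj G u v → u ≢ v
  Adj⇒≢ {u} uu refl with () ← ≡.trans (≡.sym uu) (irrefl G u)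

  #-adj : ∀ v → # (adj? v) ≡ degree G v
  #-adj v = #-≟-true (adj G v)

  #-adj≤Δ : ∀ v → # (adj? v) ≤ maxDegree G
  #-adj≤Δ v = ≤-trans (≤-reflexive (#-adj v)) (maxF-upper (degree G) v)

-- Greedy edge colouring in the order of the keys

module Greedy {n : ℕ} (G : Graph n) (key : Fin n → Fin n → ℕ)
  (key-sym : ∀ u v → key u v ≡ key v u)
  (key-injective : ∀ {u v u′ v′} → key u v ≡ key u′ v′ → (u ≡ u′ × v ≡ v′) ⊎ (u ≡ v′ × v ≡ u′))
  where
  open Adjacency G

  Earlier : ℕ → Fin n → Pred (Fin n) 0ℓ
  Earlier T v z = Adj G v z × key v z < T

  earlier? : ∀ T v → Decidable (Earlier T v)
  earlier? T v z = adj? v z ×-dec (key v z <? T)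

  -- Used for an edge `uv`, whose own label occurs in both weights and cancels in their difference,
  -- so it need not be known yet.
  DoneExcept : ℕ → Fin n → Fin n → Set
  DoneExcept T u v = ∀ z → Adj G u z → z ≢ v → key u z < T

  doneExcept? : ∀ T u v → Dec (DoneExcept T u v)
  doneExcept? T u v = Fin.all? λ z → adj? u z →-dec (¬? (z Fin.≟ v) →-dec (key u z <? T))

  -- For z ≢ b: ab is the last of the edges adjacent to az.
  DecidedBy : Fin n → Fin n → Pred (Fin n) 0ℓ
  DecidedBy a b z = (Adj G a z × z ≢ b) ×
    (DoneExcept (suc (key a b)) a z × DoneExcept (suc (key a b)) z a)

  decidedBy? : ∀ a b → Decidable (DecidedBy a b)
  decidedBy? a b z = (adj? a z ×-dec ¬? (z Fin.≟ b)) ×-dec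
    (doneExcept? (suc (key a b)) a z ×-dec doneExcept? (suc (key a b)) z a)

  -- The sum P + W for the edge `ab`, each term split over the two ends.
  load : Fin n → Fin n → ℕ
  load a b = (# earlier? (key a b) a + # earlier? (key a b) b)
           + (# decidedBy? a b + # decidedBy? b a)

  module Colouring (k : ℕ) (room : ∀ {a b} → Adj G a b → load a b < k)
    (extends : ∀ {u v} → Adj G u v → ∃ λ z → (Adj G u z × z ≢ v) ⊎ (Adj G v z × z ≢ u))
    (A : AbelianGroup 0ℓ 0ℓ) (order : HasOrder A k) where
    open AbelianGroup A renaming (refl to ≈-refl; sym to ≈-sym; trans to ≈-trans; _-_ to _⊝_)
    open import Algebra.Properties.AbelianGroup A using (∙-cancelʳ; xyx⁻¹≈y)
    open import Relation.Binary.Reasoning.Setoid setoid using (begin_; step-≈-⟩; step-≈-⟨; _∎)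
    open FiniteOrder A k order

    Labelling : Set
    Labelling = Fin n → Fin n → Carrier

    w : Labelling → Fin n → Carrier
    w = weight A G

    -- Uncoloured edges carry ε, so the partial weights are defined and w(u) − w(v) is
    -- already final once all edges adjacent to uv are coloured.
    record Partial (T : ℕ) : Set where
      field
        f         : Labelling
        symmetric : ∀ u v → f u v ≈ f v u
        uncoloured : ∀ u v → T ≤ key u v → f u v ≈ ε
        proper    : ∀ v u u′ → Earlier T v u → Earlier T v u′ → u ≢ u′ → ¬ f v u ≈ f v u′
        twin      : ∀ u v → Adj G u v → DoneExcept T u v → DoneExcept T v u → ¬ w f u ≈ w f v

    blank : Partial 0
    blank = record
      { f = λ _ _ → ε
      ; symmetric = λ _ _ → ≈-refl
      ; uncoloured = λ _ _ _ → ≈-refl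
      ; proper = λ { _ _ _ (_ , ()) }
      -- `DoneExcept 0` at both ends would mean that no edge is adjacent to `uv`, which `extends`
      -- rules out.
      ; twin = λ u v uv u-done v-done → [ impossible u-done , impossible v-done ]′ (proj₂ (extends uv))
      }
      where
      impossible : ∀ {u v z} {B : Set} → DoneExcept 0 u v → Adj G u z × z ≢ v → B
      impossible done (uz , z≢v) with () ← done _ uz z≢v

    IsEdge : Fin n → Fin n → Fin n → Fin n → Set
    IsEdge a b u v = (u ≡ a × v ≡ b) ⊎ (u ≡ b × v ≡ a)

    isEdge? : ∀ a b u v → Dec (IsEdge a b u v)
    isEdge? a b u v = ((u Fin.≟ a) ×-dec (v Fin.≟ b)) ⊎-dec ((u Fin.≟ b) ×-dec (v Fin.≟ a))

    IsEdge-sym : ∀ {a b u v} → IsEdge a b u v → IsEdge a b v u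
    IsEdge-sym (inj₁ (p , q)) = inj₂ (q , p)
    IsEdge-sym (inj₂ (p , q)) = inj₁ (q , p)

    edge-end-unique : ∀ {a b x y z} → IsEdge a b x y → IsEdge a b x z → z ≡ y
    edge-end-unique (inj₁ (_ , refl)) (inj₁ (_ , refl)) = refl
    edge-end-unique (inj₁ (refl , refl)) (inj₂ (refl , refl)) = refl
    edge-end-unique (inj₂ (refl , refl)) (inj₁ (refl , refl)) = refl
    edge-end-unique (inj₂ (_ , refl)) (inj₂ (_ , refl)) = refl

    -- Both orientations are overwritten, which keeps the labelling symmetric.
    set : Fin n → Fin n → Carrier → Labelling → Labelling
    set a b g f u v = if does (isEdge? a b u v) then g else f u v

    set-at : ∀ {a b g} f {u v} → IsEdge a b u v → set a b g f u v ≡ g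
    set-at {a} {b} f {u} {v} e rewrite dec-true (isEdge? a b u v) e = refl

    set-off : ∀ {a b g} f {u v} → ¬ IsEdge a b u v → set a b g f u v ≡ f u v
    set-off {a} {b} f {u} {v} ¬e rewrite dec-false (isEdge? a b u v) ¬e = refl

    w-set-off : ∀ {a b g} f {v} → v ≢ a → v ≢ b → w (set a b g f) v ≈ w f v
    w-set-off f {v} v≢a v≢b = gsum-cong A λ u → reflexive (cong (if adj G v u then_else ε)
      (set-off f {v} {u} λ { (inj₁ (v≡a , _)) → v≢a v≡a ; (inj₂ (v≡b , _)) → v≢b v≡b }))

    -- The previous label is `ε`, so overwriting it adds exactly `g` to one summand.
    w-set-end : ∀ {a b g} f {u v} → Adj G u v → IsEdge a b u v → f u v ≈ ε →
                w (set a b g f) u ≈ w f u ∙ g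
    w-set-end {a} {b} {g} f {u} {v} uv e fuv≈ε = gsum-update A v at off
      where
      at : (if adj G u v then set a b g f u v else ε) ≈ (if adj G u v then f u v else ε) ∙ g
      at rewrite uv | set-at {g = g} f e = ≈-sym (≈-trans (∙-congʳ fuv≈ε) (identityˡ g))
      off : ∀ z → z ≢ v → (if adj G u z then set a b g f u z else ε) ≈ (if adj G u z then f u z else ε)
      off z z≢v = reflexive (cong (if adj G u z then_else ε) (set-off f {u} {z} (z≢v ∘ edge-end-unique e)))

    shrink : ∀ {T m} → m < suc T → m ≢ T → m < T
    shrink m<1+T m≢T = ≤∧≢⇒< (s≤s⁻¹ m<1+T) m≢T

    -- Keys need not be consecutive: if `T` is the key of no edge, the times `T` and `suc T`
    -- separate the same edges.
    skip : ∀ {T} → (∀ u v → Adj G u v → key u v ≢ T) → Partial T → Partial (suc T)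
    skip {T} none s = record
      { f = f
      ; symmetric = symmetric
      ; uncoloured = λ u v T<key → uncoloured u v (<⇒≤ T<key)
      ; proper = λ v u u′ e e′ → proper v u u′ (earlier e) (earlier e′)
      ; twin = λ u v uv du dv → twin u v uv (done du) (done dv)
      }
      where
      open Partial s
      earlier : ∀ {v u} → Earlier (suc T) v u → Earlier T v u
      earlier (vu , key<) = vu , shrink key< (none _ _ vu)
      done : ∀ {u v} → DoneExcept (suc T) u v → DoneExcept T u v
      done d z uz z≢v = shrink (d z uz z≢v) (none _ _ uz)

    -- For `z` off the new edge, `w u` becomes `w u ∙ g` while `w z` stays, so the two agree only
    -- for the single value `w z ⊝ w u`, which `g-twin` excludes.
    module Extend {a b : Fin n} (ab : Adj G a b) (s : Partial (key a b)) (g : Carrier)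
      (g-fresh : ∀ {u v z} → IsEdge a b u v → Earlier (key a b) u z → ¬ g ≈ Partial.f s u z)
      (g-twin : ∀ {u v z} → IsEdge a b u v → DecidedBy u v z →
                ¬ g ≈ w (Partial.f s) z ⊝ w (Partial.f s) u)
      where
      open Partial s

      T : ℕ
      T = key a b

      f′ : Labelling
      f′ = set a b g f

      f′-at : ∀ {u v} → IsEdge a b u v → f′ u v ≈ g
      f′-at e = reflexive (set-at f e)

      f′-off : ∀ {u v} → ¬ IsEdge a b u v → f′ u v ≈ f u v
      f′-off ¬e = reflexive (set-off f ¬e)

      key-edge : ∀ {u v} → IsEdge a b u v → key u v ≡ T
      key-edge (inj₁ (refl , refl)) = refl
      key-edge (inj₂ (refl , refl)) = key-sym b a

      Adj-edge : ∀ {u v} → IsEdge a b u v → Adj G u v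
      Adj-edge (inj₁ (refl , refl)) = ab
      Adj-edge (inj₂ (refl , refl)) = Adj-sym ab

      edge-unique : ∀ {u v} → key u v ≡ T → IsEdge a b u v
      edge-unique = key-injective

      w-end : ∀ {u v} → IsEdge a b u v → w f′ u ≈ w f u ∙ g
      w-end e = w-set-end f (Adj-edge e) e (uncoloured _ _ (≤-reflexive (≡.sym (key-edge e))))

      symmetric′ : ∀ u v → f′ u v ≈ f′ v u
      symmetric′ u v = case isEdge? a b u v of λ where
        (yes e) → ≈-trans (f′-at e) (≈-sym (f′-at (IsEdge-sym e)))
        (no ¬e) → ≈-trans (f′-off ¬e) (≈-trans (symmetric u v) (≈-sym (f′-off (¬e ∘ IsEdge-sym))))

      uncoloured′ : ∀ u v → suc T ≤ key u v → f′ u v ≈ ε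
      uncoloured′ u v T<key = ≈-trans (f′-off (λ e → >⇒≢ T<key (key-edge e))) (uncoloured u v (<⇒≤ T<key))

      proper′ : ∀ v u u′ → Earlier (suc T) v u → Earlier (suc T) v u′ → u ≢ u′ → ¬ f′ v u ≈ f′ v u′
      proper′ v u u′ (vu , k<) (vu′ , k′<) u≢u′ eq = case isEdge? a b v u of λ where
        (yes e) → case isEdge? a b v u′ of λ where
          (yes e′) → u≢u′ (edge-end-unique e′ e)
          (no ¬e′) → g-fresh e (vu′ , shrink k′< (¬e′ ∘ edge-unique))
            (≈-trans (≈-sym (f′-at e)) (≈-trans eq (f′-off ¬e′)))
        (no ¬e) → case isEdge? a b v u′ of λ where
          (yes e′) → g-fresh e′ (vu , shrink k< (¬e ∘ edge-unique))
            (≈-trans (≈-sym (f′-at e′)) (≈-trans (≈-sym eq) (f′-off ¬e)))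
          (no ¬e′) → proper v u u′
            (vu , shrink k< (¬e ∘ edge-unique)) (vu′ , shrink k′< (¬e′ ∘ edge-unique)) u≢u′
            (≈-trans (≈-sym (f′-off ¬e)) (≈-trans eq (f′-off ¬e′)))

      twin-at : ∀ {u v z} → IsEdge a b u v → Adj G u z → z ≢ v →
                DoneExcept (suc T) u z → DoneExcept (suc T) z u → ¬ w f′ u ≈ w f′ z
      twin-at {u} {v} {z} e uz z≢v du dz eq =
        g-twin e ((uz , z≢v) , cast du , cast dz) (begin
          g                       ≈⟨ xyx⁻¹≈y (w f u) g ⟨
          w f u ∙ g ∙ w f u ⁻¹    ≈⟨ ∙-congʳ (≈-trans (≈-sym (w-end e)) (≈-trans eq (w-z e))) ⟩
          w f z ∙ w f u ⁻¹        ∎)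
        where
        cast : ∀ {x y} → DoneExcept (suc T) x y → DoneExcept (suc (key u v)) x y
        cast {x} {y} = subst (λ t → DoneExcept (suc t) x y) (≡.sym (key-edge e))
        w-z : IsEdge a b u v → w f′ z ≈ w f z
        w-z (inj₁ (refl , refl)) = w-set-off f (Adj⇒≢ (Adj-sym uz)) z≢v
        w-z (inj₂ (refl , refl)) = w-set-off f z≢v (Adj⇒≢ (Adj-sym uz))

      -- Both weights gain `g`, which cancels. All edges adjacent to `ab` were coloured before it,
      -- so the partial colouring already separates its ends.
      twin-edge : ∀ {u v} → IsEdge a b u v → DoneExcept (suc T) u v → DoneExcept (suc T) v u →
                  ¬ w f′ u ≈ w f′ v
      twin-edge {u} {v} e du dv eq = twin u v (Adj-edge e) (done e du) (done (IsEdge-sym e) dv)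
        (∙-cancelʳ g _ _ (≈-trans (≈-sym (w-end e)) (≈-trans eq (w-end (IsEdge-sym e)))))
        where
        done : ∀ {x y} → IsEdge a b x y → DoneExcept (suc T) x y → DoneExcept T x y
        done e d z xz z≢y = shrink (d z xz z≢y) (z≢y ∘ edge-end-unique e ∘ edge-unique)

      -- Neither weight changes, and the edge with key `T` meets neither `u` nor `v`, so the
      -- condition was already settled at time `T`.
      twin-off : ∀ {u v} → u ≢ a → u ≢ b → v ≢ a → v ≢ b → Adj G u v →
                 DoneExcept (suc T) u v → DoneExcept (suc T) v u → ¬ w f′ u ≈ w f′ v
      twin-off u≢a u≢b v≢a v≢b uv du dv eq = twin _ _ uv (done u≢a u≢b du) (done v≢a v≢b dv)
        (≈-trans (≈-sym (w-set-off f u≢a u≢b)) (≈-trans eq (w-set-off f v≢a v≢b)))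
        where
        done : ∀ {x y} → x ≢ a → x ≢ b → DoneExcept (suc T) x y → DoneExcept T x y
        done x≢a x≢b d z xz z≢y = shrink (d z xz z≢y)
          ([ x≢a ∘ proj₁ , x≢b ∘ proj₁ ]′ ∘ edge-unique)

      twin-end : ∀ {u v z} → IsEdge a b u v → Adj G u z →
                 DoneExcept (suc T) u z → DoneExcept (suc T) z u → ¬ w f′ u ≈ w f′ z
      twin-end {v = v} {z} e uz du dz with z Fin.≟ v
      ... | yes refl = twin-edge e du dz
      ... | no z≢v   = twin-at e uz z≢v du dz

      end? : ∀ x → (∃ λ y → IsEdge a b x y) ⊎ (x ≢ a × x ≢ b)
      end? x with x Fin.≟ a | x Fin.≟ b
      ... | yes x≡a | _       = inj₁ (b , inj₁ (x≡a , refl))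
      ... | no _    | yes x≡b = inj₁ (a , inj₂ (x≡b , refl))
      ... | no x≢a  | no x≢b  = inj₂ (x≢a , x≢b)

      twin′ : ∀ u v → Adj G u v → DoneExcept (suc T) u v → DoneExcept (suc T) v u → ¬ w f′ u ≈ w f′ v
      twin′ u v uv du dv = case end? u of λ where
        (inj₁ (_ , e)) → twin-end e uv du dv
        (inj₂ (u≢a , u≢b)) → case end? v of λ where
          (inj₁ (_ , e)) → twin-end e (Adj-sym uv) dv du ∘ ≈-sym
          (inj₂ (v≢a , v≢b)) → twin-off u≢a u≢b v≢a v≢b uv du dv

      extended : Partial (suc T)
      extended = record { f = f′ ; symmetric = symmetric′ ; uncoloured = uncoloured′ ; proper = proper′ ; twin = twin′ }

    colour-edge : ∀ {a b} → Adj G a b → Partial (key a b) → Partial (suc (key a b))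
    colour-edge {a} {b} ab s = Extend.extended ab s (proj₁ choice) fresh twinned
      where
      open Partial s
      T = key a b
      used = λ x → values (earlier? T x) (f x)
      blocked = λ x y → values (decidedBy? x y) (λ z → w f z ⊝ w f x)
      forbidden = (used a ++ used b) ++ (blocked a b ++ blocked b a)
      length-forbidden : length forbidden ≡ load a b
      length-forbidden
        rewrite length-++ (used a ++ used b) {blocked a b ++ blocked b a}
              | length-++ (used a) {used b} | length-++ (blocked a b) {blocked b a}
              | length-values (earlier? T a) (f a) | length-values (earlier? T b) (f b)
              | length-values (decidedBy? a b) (λ z → w f z ⊝ w f a)
              | length-values (decidedBy? b a) (λ z → w f z ⊝ w f b) = refl
      choice : ∃ λ g → All (λ x → ¬ g ≈ x) forbidden
      choice = avoid forbidden (<-≤-trans (s≤s (≤-reflexive length-forbidden)) (room ab))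
      allowed = ++⁻ (used a ++ used b) (proj₂ choice)
      fresh : ∀ {u v z} → IsEdge a b u v → Earlier T u z → ¬ proj₁ choice ≈ f u z
      fresh (inj₁ (refl , refl)) = values⁻ (earlier? T a) (proj₁ (++⁻ (used a) (proj₁ allowed))) _
      fresh (inj₂ (refl , refl)) = values⁻ (earlier? T b) (proj₂ (++⁻ (used a) (proj₁ allowed))) _
      twinned : ∀ {u v z} → IsEdge a b u v → DecidedBy u v z → ¬ proj₁ choice ≈ w f z ⊝ w f u
      twinned (inj₁ (refl , refl)) = values⁻ (decidedBy? a b) (proj₁ (++⁻ (blocked a b) (proj₂ allowed))) _
      twinned (inj₂ (refl , refl)) = values⁻ (decidedBy? b a) (proj₂ (++⁻ (blocked a b) (proj₂ allowed))) _

    step : ∀ T → Partial T → Partial (suc T)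
    step T s with Fin.any? (λ u → Fin.any? (λ v → adj? u v ×-dec (key u v ≟ T)))
    ... | yes (u , v , uv , refl) = colour-edge uv s
    ... | no none = skip (λ u v uv eq → none (u , v , uv , eq)) s

    partial : ∀ T → Partial T
    partial zero    = blank
    partial (suc T) = step T (partial T)

    twinColouring : ∀ T → (∀ u v → key u v < T) → Σ _ λ f → IsTwinColoring A G f
    twinColouring T bound = f
      , (λ u v _ → symmetric u v)
      , (λ v u u′ vu vu′ → proper v u u′ (vu , bound v u) (vu′ , bound v u′))
      , (λ u v uv → twin u v uv (λ z _ _ → bound u z) (λ z _ _ → bound v z))
      where open Partial (partial T)

-- Elimination orders for an antitone removal condition

does⇒witness : ∀ {B : Set} (b? : Dec B) → does b? ≡ true → B
does⇒witness (yes b) _ = b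

-- Q S v reads: v may be removed from S. Vertices removed first get the largest positions.
eliminationOrder : ∀ {n} {Q : (Fin n → Bool) → Fin n → Set} →
  (∀ {S R v} → (∀ u → R u ≡ true → S u ≡ true) → Q S v → Q R v) →
  (∀ S → (∃ λ v → S v ≡ true) → ∃ λ v → S v ≡ true × Q S v) →
  ∀ m S → # (λ v → S v Bool.≟ true) ≤ m →
  Σ (Fin n → ℕ) λ pos → (∀ v → S v ≡ true → pos v < m) ×
    (∀ {u v} → S u ≡ true → S v ≡ true → pos u ≡ pos v → u ≡ v) ×
    (∀ {R v} → S v ≡ true → (∀ u → R u ≡ true → S u ≡ true × pos u ≤ pos v) → Q R v)
eliminationOrder {n} {Q} antitone pick m S #S≤m with Fin.any? (λ v → S v Bool.≟ true)
... | no empty = (λ _ → 0) , (λ v Sv → none Sv) , (λ Su → none Su) , (λ Sv → none Sv)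
  where
  none : ∀ {B : Set} {v} → S v ≡ true → B
  none Sv = contradiction (_ , Sv) empty
... | yes (_ , Su) with m
...   | zero = contradiction #S≤m (<⇒≱ (#-nonempty (λ v → S v Bool.≟ true) Su))
...   | suc m with pick S (_ , Su)
...     | last , S-last , Q-last = pos , pos<m , pos-injective , elim
  where
  S? : Decidable (λ v → S v ≡ true)
  S? v = S v Bool.≟ true
  S′ : Fin n → Bool
  S′ v = does ((S? without last) v)
  S′⁺ : ∀ {v} → S v ≡ true → v ≢ last → S′ v ≡ true
  S′⁺ {v} Sv v≢ = dec-true ((S? without last) v) (Sv , v≢)
  S′⁻ : ∀ {v} → S′ v ≡ true → S v ≡ true × v ≢ last
  S′⁻ {v} = does⇒witness ((S? without last) v)
  rest = eliminationOrder {Q = Q} antitone pick m S′ (≤-trans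
    (#-mono (λ v → S′ v Bool.≟ true) (S? without last) S′⁻)
    (s≤s⁻¹ (≤-trans (#-without S? S-last) #S≤m)))
  pos′ = proj₁ rest
  pos′<m = proj₁ (proj₂ rest)
  pos : Fin n → ℕ
  pos v = if does (v Fin.≟ last) then m else pos′ v
  pos-last : ∀ {v} → v ≡ last → pos v ≡ m
  pos-last {v} eq rewrite dec-true (v Fin.≟ last) eq = refl
  pos-other : ∀ {v} → v ≢ last → pos v ≡ pos′ v
  pos-other {v} neq rewrite dec-false (v Fin.≟ last) neq = refl
  pos-other< : ∀ {v} → S v ≡ true → v ≢ last → pos v < m
  pos-other< {v} Sv neq = subst (_< m) (≡.sym (pos-other neq)) (pos′<m v (S′⁺ Sv neq))
  pos<m : ∀ v → S v ≡ true → pos v < suc m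
  pos<m v Sv = case v Fin.≟ last of λ where
    (yes eq) → s≤s (≤-reflexive (pos-last eq))
    (no neq) → m<n⇒m<1+n (pos-other< Sv neq)
  pos-injective : ∀ {u v} → S u ≡ true → S v ≡ true → pos u ≡ pos v → u ≡ v
  pos-injective {u} {v} Su Sv eq = case u Fin.≟ last of λ where
    (yes u≡) → case v Fin.≟ last of λ where
      (yes v≡) → ≡.trans u≡ (≡.sym v≡)
      (no v≢) → contradiction (≡.trans (≡.sym eq) (pos-last u≡)) (<⇒≢ (pos-other< Sv v≢))
    (no u≢) → case v Fin.≟ last of λ where
      (yes v≡) → contradiction (≡.trans eq (pos-last v≡)) (<⇒≢ (pos-other< Su u≢))
      (no v≢) → proj₁ (proj₂ (proj₂ rest)) (S′⁺ Su u≢) (S′⁺ Sv v≢)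
        (≡.trans (≡.sym (pos-other u≢)) (≡.trans eq (pos-other v≢)))
  elim : ∀ {R v} → S v ≡ true → (∀ u → R u ≡ true → S u ≡ true × pos u ≤ pos v) → Q R v
  elim {R} {v} Sv R⊆ = case v Fin.≟ last of λ where
    (yes v≡) → subst (Q R) (≡.sym v≡) (antitone (λ u Ru → proj₁ (R⊆ u Ru)) Q-last)
    -- The position `m` of `last` exceeds `pos v`, so `R` misses `last`, lies in `S′`, and the
    -- recursive order applies.
    (no v≢) → proj₂ (proj₂ (proj₂ rest)) (S′⁺ Sv v≢) λ u Ru →
      let u≢ = λ u≡ → <⇒≱ (pos-other< Sv v≢) (subst (_≤ pos v) (pos-last u≡) (proj₂ (R⊆ u Ru))) in
      S′⁺ (proj₁ (R⊆ u Ru)) u≢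
      , ≡.subst₂ _≤_ (pos-other u≢) (pos-other v≢) (proj₂ (R⊆ u Ru))

-- Degeneracy orders with the leaves at the end

module Degeneracy {n : ℕ} (G : Graph n) where
  open Adjacency G

  Leaf : Fin n → Set
  Leaf v = # (adj? v) ≤ 1

  leaf? : Decidable Leaf
  leaf? v = # (adj? v) ≤? 1

  record DegeneracyOrder (c : ℕ) : Set where
    field
      pos           : Fin n → ℕ
      pos<n         : ∀ v → pos v < n
      pos-injective : ∀ {u v} → pos u ≡ pos v → u ≡ v

    Back : Fin n → Pred (Fin n) 0ℓ
    Back v u = Adj G v u × pos u < pos v

    back? : ∀ v → Decidable (Back v)
    back? v u = adj? v u ×-dec (pos u <? pos v)

    field
      #-back      : ∀ v → # (back? v) < c
      leaves-last : ∀ {u v} → pos u < pos v → Leaf u → Leaf v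

  -- As long as a leaf of `G` is left, a leaf is removed; `2 ≤ c` makes its degree small enough.
  -- After that the coloring property of the induced subgraph supplies the vertex. Since vertices
  -- removed first get the largest positions, the leaves come last.
  ColProp⇒order : ∀ {c} → 2 ≤ c → ColProp G c → DegeneracyOrder c
  ColProp⇒order {c} 2≤c col = record
    { pos = pos
    ; pos<n = λ v → proj₁ (proj₂ order) v refl
    ; pos-injective = proj₁ (proj₂ (proj₂ order)) refl refl
    ; #-back = λ v → ≤-<-trans
        (#-mono (λ u → adj? v u ×-dec (pos u <? pos v)) (nbrIn? (upTo v) v)
          (λ {u} (vu , u<v) → vu , dec-true (pos u ≤? pos v) (<⇒≤ u<v)))
        (proj₁ (elim v))
    ; leaves-last = λ {u} {v} u<v → proj₂ (elim v) u (dec-true (pos u ≤? pos v) (<⇒≤ u<v))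
    }
    where
    nbrIn? : (S : Fin n → Bool) → ∀ v → Decidable (λ u → Adj G v u × S u ≡ true)
    nbrIn? S v u = adj? v u ×-dec (S u Bool.≟ true)

    -- The second clause makes the leaves go first. It speaks of leaves of `G`, not of the remaining
    -- graph, and so passes to subsets of `S`.
    Removable : (Fin n → Bool) → Fin n → Set
    Removable S v = # (nbrIn? S v) < c × (∀ u → S u ≡ true → Leaf u → Leaf v)

    antitone : ∀ {S R v} → (∀ u → R u ≡ true → S u ≡ true) → Removable S v → Removable R v
    antitone {S} {R} {v} R⊆S (few , leaf) =
      ≤-<-trans (#-mono (nbrIn? R v) (nbrIn? S v) (λ (vu , Ru) → vu , R⊆S _ Ru)) few
      , λ u Ru → leaf u (R⊆S u Ru)

    induced : (Fin n → Bool) → Subgraph G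
    induced S = record
      { S = S
      ; E = λ u v → adj G u v ∧ (S u ∧ S v)
      ; E-sym = λ u v → cong₂ _∧_ (sym G u v) (Bool.∧-comm (S u) (S v))
      ; E⊆G = λ u v → Bool.∧-conicalˡ (adj G u v) (S u ∧ S v)
      ; E⊆S = λ u v uv → Bool.∧-conicalˡ (S u) (S v) (Bool.∧-conicalʳ (adj G u v) (S u ∧ S v) uv)
      }

    pick : ∀ S → (∃ λ v → S v ≡ true) → ∃ λ v → S v ≡ true × Removable S v
    pick S nonempty with Fin.any? (λ v → (S v Bool.≟ true) ×-dec leaf? v)
    ... | yes (v , Sv , leaf) = v , Sv
      , ≤-<-trans (#-mono (nbrIn? S v) (adj? v) proj₁) (≤-<-trans leaf 2≤c)
      , λ _ _ _ → leaf
    ... | no no-leaf with col (induced S) nonempty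
    ...   | v , Sv , few = v , Sv
      , ≤-<-trans (≤-trans (#-mono (nbrIn? S v) (λ u → (adj G v u ∧ (S v ∧ S u)) Bool.≟ true)
                     (λ (vu , Su) → cong₂ _∧_ vu (cong₂ _∧_ Sv Su)))
                   (≤-reflexive (#-≟-true (λ u → adj G v u ∧ (S v ∧ S u))))) few
      , λ u Su leaf → contradiction (u , Su , leaf) no-leaf

    order = eliminationOrder {Q = Removable} antitone pick n (λ _ → true) (#-true≤ n)
      where
      #-true≤ : ∀ m → # (λ (v : Fin m) → true Bool.≟ true) ≤ m
      #-true≤ zero    = z≤n
      #-true≤ (suc m) = s≤s (#-true≤ m)

    pos = proj₁ order

    upTo : Fin n → Fin n → Bool
    upTo v u = does (pos u ≤? pos v)

    elim : ∀ v → Removable (upTo v) v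
    elim v = proj₂ (proj₂ (proj₂ order)) refl λ u u∈ → refl , does⇒witness (pos u ≤? pos v) u∈

-- Lexicographic keys for edges

module LexKey {n : ℕ} (pos : Fin n → ℕ) (pos<n : ∀ v → pos v < n)
  (pos-injective : ∀ {u v} → pos u ≡ pos v → u ≡ v) where

  -- The lower and the upper position are the two digits of a number in base `n`, so the order of
  -- the keys is lexicographic.
  key : Fin n → Fin n → ℕ
  key u v = (pos u ⊓ pos v) * n + (pos u ⊔ pos v)

  lex-< : ∀ {m m′ M M′} → M < n → m < m′ → m * n + M < m′ * n + M′
  lex-< {m} {m′} {M} {M′} M<n m<m′ = begin-strict
    m * n + M   <⟨ +-monoʳ-< (m * n) M<n ⟩
    m * n + n   ≡⟨ +-comm (m * n) n ⟩
    suc m * n   ≤⟨ *-monoˡ-≤ n m<m′ ⟩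
    m′ * n      ≤⟨ m≤m+n (m′ * n) M′ ⟩
    m′ * n + M′ ∎
    where open ≤-Reasoning

  max<n : ∀ u v → pos u ⊔ pos v < n
  max<n u v = ⊔-lub-< (pos<n u) (pos<n v)
    where
    ⊔-lub-< : ∀ {a b} → a < n → b < n → a ⊔ b < n
    ⊔-lub-< = ⊔-lub

  -- The trailing `+ 0` writes the bound with leading digit `n` and last digit 0, so that `lex-<`
  -- applies.
  key-bound : ∀ u v → key u v < n * n + 0
  key-bound u v = lex-< (max<n u v) (≤-<-trans (m⊓n≤m (pos u) (pos v)) (pos<n u))

  key-sym : ∀ u v → key u v ≡ key v u
  key-sym u v = cong₂ (λ m M → m * n + M) (⊓-comm (pos u) (pos v)) (⊔-comm (pos u) (pos v))

  key-injective : ∀ {u v u′ v′} → key u v ≡ key u′ v′ → (u ≡ u′ × v ≡ v′) ⊎ (u ≡ v′ × v ≡ u′)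
  key-injective {u} {v} {u′} {v′} eq = cases min≡ max≡
    where
    min≡ : pos u ⊓ pos v ≡ pos u′ ⊓ pos v′
    min≡ with <-cmp (pos u ⊓ pos v) (pos u′ ⊓ pos v′)
    ... | tri< lt _ _ = contradiction eq (<⇒≢ (lex-< (max<n u v) lt))
    ... | tri≈ _ e _  = e
    ... | tri> _ _ gt = contradiction (≡.sym eq) (<⇒≢ (lex-< (max<n u′ v′) gt))
    max≡ : pos u ⊔ pos v ≡ pos u′ ⊔ pos v′
    max≡ = +-cancelˡ-≡ ((pos u ⊓ pos v) * n) _ _
      (≡.trans eq (cong (λ m → m * n + (pos u′ ⊔ pos v′)) (≡.sym min≡)))
    cases : pos u ⊓ pos v ≡ pos u′ ⊓ pos v′ → pos u ⊔ pos v ≡ pos u′ ⊔ pos v′ →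
            (u ≡ u′ × v ≡ v′) ⊎ (u ≡ v′ × v ≡ u′)
    cases min≡ max≡ with ≤-total (pos u) (pos v) | ≤-total (pos u′) (pos v′)
    ... | inj₁ p | inj₁ q rewrite m≤n⇒m⊓n≡m p | m≤n⇒m⊓n≡m q | m≤n⇒m⊔n≡n p | m≤n⇒m⊔n≡n q =
      inj₁ (pos-injective min≡ , pos-injective max≡)
    ... | inj₁ p | inj₂ q rewrite m≤n⇒m⊓n≡m p | m≥n⇒m⊓n≡n q | m≤n⇒m⊔n≡n p | m≥n⇒m⊔n≡m q =
      inj₂ (pos-injective min≡ , pos-injective max≡)
    ... | inj₂ p | inj₁ q rewrite m≥n⇒m⊓n≡n p | m≤n⇒m⊓n≡m q | m≥n⇒m⊔n≡m p | m≤n⇒m⊔n≡n q =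
      inj₂ (pos-injective max≡ , pos-injective min≡)
    ... | inj₂ p | inj₂ q rewrite m≥n⇒m⊓n≡n p | m≥n⇒m⊓n≡n q | m≥n⇒m⊔n≡m p | m≥n⇒m⊔n≡m q =
      inj₁ (pos-injective max≡ , pos-injective min≡)

  key-<-min : ∀ {a b u v} → pos a < pos u → pos a < pos v → key a b < key u v
  key-<-min {a} {b} a<u a<v = lex-< (max<n a b) (≤-<-trans (m⊓n≤m (pos a) (pos b)) (⊓-glb a<u a<v))

  key-<-max : ∀ {a b z} → pos a < pos b → pos b < pos z → key a b < key a z
  key-<-max a<b b<z
    rewrite m≤n⇒m⊓n≡m (<⇒≤ a<b) | m≤n⇒m⊔n≡n (<⇒≤ a<b)
          | m≤n⇒m⊓n≡m (<⇒≤ (<-trans a<b b<z)) | m≤n⇒m⊔n≡n (<⇒≤ (<-trans a<b b<z)) =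
    +-monoʳ-< _ b<z

-- Bounds on the number of forbidden values

module Room {n : ℕ} (G : Graph n) {c : ℕ} (ord : Degeneracy.DegeneracyOrder G c) where
  open Adjacency G
  open Degeneracy G
  open DegeneracyOrder ord
  open LexKey pos pos<n pos-injective
  open Greedy G key key-sym key-injective

  load-sym : ∀ a b → load a b ≡ load b a
  load-sym a b = cong₂ _+_
    (≡.trans (cong (λ T → # earlier? T a + # earlier? T b) (key-sym a b)) (+-comm (# earlier? (key b a) a) _))
    (+-comm (# decidedBy? a b) (# decidedBy? b a))

  earlier⇒≢ : ∀ {a b z} → Earlier (key a b) a z → z ≢ b
  earlier⇒≢ (_ , lt) refl = <-irrefl refl lt

  #-earlier : ∀ {a b} → Adj G a b → # earlier? (key a b) a < maxDegree G
  #-earlier {a} {b} ab = <-≤-trans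
    (≤-<-trans (#-mono (earlier? (key a b) a) (adj? a without b) (λ e → proj₁ e , earlier⇒≢ e))
               (#-without (adj? a) ab))
    (#-adj≤Δ a)

  -- An edge from `b` to a vertex after `b` has `pos b` as its lower position and so comes after
  -- `ab`. Hence earlier edges at `b` lead backwards, and of the at most c - 1 backward neighbours
  -- `a` is not counted.
  #-earlier-upper : ∀ {a b} → Adj G a b → pos a < pos b → 2 + # earlier? (key a b) b ≤ c
  #-earlier-upper {a} {b} ab a<b = ≤-trans
    (s≤s (≤-trans (s≤s (#-mono (earlier? (key a b) b) (back? b without a) earlier⇒back))
                  (#-without (back? b) (Adj-sym ab , a<b))))
    (#-back b)
    where
    earlier⇒back : ∀ {z} → Earlier (key a b) b z → Back b z × z ≢ a
    earlier⇒back {z} (bz , lt) =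
      (bz , ≰⇒> (λ b≤z → <⇒≯ lt (key-<-min a<b (<-≤-trans a<b b≤z))))
      , λ { refl → <⇒≢ lt (key-sym b z) }

  Later : Fin n → Fin n → Pred (Fin n) 0ℓ
  Later a b z = Adj G a z × key a b < key a z

  later? : ∀ a b → Decidable (Later a b)
  later? a b z = adj? a z ×-dec (key a b <? key a z)

  -- A later edge `az` violates `DoneExcept` for every other candidate at `a`, so only `az` itself
  -- can be decided by `ab`.
  later⇒#-decided≤1 : ∀ {a b} → ∃ (Later a b) → # decidedBy? a b ≤ 1
  later⇒#-decided≤1 {a} {b} (z , az , lt) =
    #-subsingleton (decidedBy? a b) λ p q → ≡.trans (only p) (≡.sym (only q))
    where
    only : ∀ {x} → DecidedBy a b x → x ≡ z
    only {x} (_ , done , _) = case x Fin.≟ z of λ where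
      (yes x≡z) → x≡z
      (no x≢z)  → contradiction (done z az (x≢z ∘ ≡.sym)) (≤⇒≯ lt)

  -- Without later edges at `a`, every edge there other than `ab` is earlier, because distinct edges
  -- have distinct keys.
  ¬later⇒#-decided≤#-earlier : ∀ {a b} → ¬ ∃ (Later a b) → # decidedBy? a b ≤ # earlier? (key a b) a
  ¬later⇒#-decided≤#-earlier {a} {b} last = #-mono (decidedBy? a b) (earlier? (key a b) a)
    λ {z} ((az , z≢b) , _) → az , ≤∧≢⇒< (≮⇒≥ (λ lt → last (z , az , lt)))
      λ eq → case key-injective eq of λ where
        (inj₁ (_ , z≡b)) → z≢b z≡b
        (inj₂ (refl , z≡a)) → z≢b z≡a

  #-decided : ∀ a b → # decidedBy? a b ≤ # earlier? (key a b) a ⊔ 1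
  #-decided a b with Fin.any? (later? a b)
  ... | yes later = ≤-trans (later⇒#-decided≤1 later) (m≤n⊔m _ 1)
  ... | no last   = ≤-trans (¬later⇒#-decided≤#-earlier last) (m≤m⊔n _ 1)

  #-decided-upper : ∀ a b → # decidedBy? b a ≤ # earlier? (key a b) b ⊔ 1
  #-decided-upper a b = ≤-trans (#-decided b a)
    (≤-reflexive (cong (λ T → # earlier? T b ⊔ 1) (key-sym b a)))

  #-decided-lower : 2 ≤ maxDegree G → ∀ {a b} → Adj G a b → # decidedBy? a b < maxDegree G
  #-decided-lower 2≤Δ {a} {b} ab = ≤-<-trans (#-decided a b) (⊔-lub (#-earlier ab) 2≤Δ)

  -- The extreme values Δ - 1, c - 2, Δ - 1, c - 2 add up to 2(Δ + c) - 6.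
  load-arith : ∀ {Δ c p q x y} → p < Δ → 2 + q ≤ c → x < Δ → 2 + y ≤ c →
               (p + q) + (x + y) < 2 * (Δ + c) ∸ 5
  load-arith {Δ} {c} {p} {q} {x} {y} p<Δ q≤ x<Δ y≤ = m+n≤o⇒m≤o∸n (suc ((p + q) + (x + y))) (begin
    suc ((p + q) + (x + y)) + 5                 ≡⟨ regroup p q x y ⟩
    (suc p + (2 + q)) + (suc x + (2 + y))       ≤⟨ +-mono-≤ (+-mono-≤ p<Δ q≤) (+-mono-≤ x<Δ y≤) ⟩
    (Δ + c) + (Δ + c)                           ≡⟨ cong (Δ + c +_) (+-identityʳ (Δ + c)) ⟨
    2 * (Δ + c)                                 ∎)
    where
    open ≤-Reasoning
    regroup : ∀ p q x y → suc ((p + q) + (x + y)) + 5 ≡ (suc p + (2 + q)) + (suc x + (2 + y))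
    regroup = solve-∀

  load-3≤c : 2 ≤ maxDegree G → 3 ≤ c → ∀ {a b} → Adj G a b → pos a < pos b →
             load a b < 2 * (maxDegree G + c) ∸ 5
  load-3≤c 2≤Δ 3≤c {a} {b} ab a<b = load-arith
    (#-earlier ab) (#-earlier-upper ab a<b) (#-decided-lower 2≤Δ ab)
    -- The maximum with 1 matters if no earlier edge meets `b`; then `3 ≤ c` is what is required.
    (≤-trans (s≤s (s≤s (#-decided-upper a b))) (⊔-lub (#-earlier-upper ab a<b) 3≤c))

  -- Let z come after a. If z is not a leaf, az is decided only after ab, by an edge from
  -- z to a later vertex; if z is a leaf, then az itself comes after ab.
  forest-#-decided : c ≡ 2 → ∀ {a b} → Adj G a b → pos a < pos b → ¬ Leaf b → # decidedBy? a b ≤ 1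
  forest-#-decided refl {a} {b} ab a<b ¬leaf with Fin.any? (later? a b)
  ... | yes later = later⇒#-decided≤1 later
  ... | no last   = ≤-trans (#-mono (decidedBy? a b) (back? a) decided⇒back) (s≤s⁻¹ (#-back a))
    where
    decided⇒back : ∀ {z} → DecidedBy a b z → Back a z
    decided⇒back {z} ((az , z≢b) , _ , done) with <-cmp (pos z) (pos a)
    ... | tri< z<a _ _ = az , z<a
    ... | tri≈ _ z≡a _ = contradiction (≡.sym (pos-injective z≡a)) (Adj⇒≢ az)
    ... | tri> _ _ a<z with leaf? z | <-cmp (pos z) (pos b)
    -- A leaf before `b` would by `leaves-last` make `b` a leaf too.
    ...   | yes leaf | tri< z<b _ _ = contradiction (leaves-last z<b leaf) ¬leaf
    ...   | yes leaf | tri≈ _ z≡b _ = contradiction (pos-injective z≡b) z≢b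
    ...   | yes leaf | tri> _ _ b<z = contradiction (z , az , key-<-max a<b b<z) last
    ...   | no ¬leaf | _ with #-witness-≢ (adj? z) (≰⇒> ¬leaf) a
    ...     | y , zy , y≢a = contradiction (done y zy y≢a)
      (≤⇒≯ (key-<-min a<z (<-≤-trans a<z (≮⇒≥ y≮z))))
      where
      -- With `c ≡ 2` a vertex has at most one neighbour before it, and for `z` this is `a`.
      y≮z : ¬ pos y < pos z
      y≮z y<z = y≢a (#≤1⇒unique (back? z) (s≤s⁻¹ (#-back z)) (zy , y<z) (Adj-sym az , a<z))

  -- If `ab` decides no other edge at `b`, the general bounds suffice. Otherwise `b` has a second
  -- neighbour, so it is no leaf, and at most one edge is decided at each end.
  load-forest : c ≡ 2 → 3 ≤ maxDegree G → ∀ {a b} → Adj G a b → pos a < pos b →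
             load a b < 2 * (maxDegree G + c) ∸ 5
  load-forest refl 3≤Δ {a} {b} ab a<b with # decidedBy? b a in eq
  ... | zero  = load-arith (#-earlier ab) (#-earlier-upper ab a<b) (#-decided-lower (<⇒≤ 3≤Δ) ab) ≤-refl
  ... | suc m = ≤-<-trans (+-monoʳ-≤ (# earlier? (key a b) a + # earlier? (key a b) b) few)
    -- The at most 2 decided edges are entered as `x = 2` and `y = 0`, so that `x < Δ` reads
    -- `3 ≤ Δ`.
    (load-arith (#-earlier ab) (#-earlier-upper ab a<b) 3≤Δ ≤-refl)
    where
    ¬leaf : ¬ Leaf b
    ¬leaf leaf with #-witness (decidedBy? b a) (subst (0 <_) (≡.sym eq) (s≤s z≤n))
    ... | z , (bz , z≢a) , _ = z≢a (#≤1⇒unique (adj? b) leaf bz (Adj-sym ab))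
    none-earlier : # earlier? (key a b) b ≡ 0
    none-earlier = n≤0⇒n≡0 (s≤s⁻¹ (s≤s⁻¹ (#-earlier-upper ab a<b)))
    few : # decidedBy? a b + suc m ≤ 2 + 0
    few = +-mono-≤ {y = 1} {v = 1} (forest-#-decided refl ab a<b ¬leaf)
      (subst (_≤ 1) eq (≤-trans (#-decided-upper a b) (≤-reflexive (cong (_⊔ 1) none-earlier))))

  module _ (extends : ∀ {u v} → Adj G u v → ∃ λ z → (Adj G u z × z ≢ v) ⊎ (Adj G v z × z ≢ u)) where

    -- The load is symmetric, so bounding it for `a` before `b` is enough. All keys lie below
    -- `n * n`, hence by that time every edge is coloured.
    colouring : ∀ {k} → (∀ {a b} → Adj G a b → pos a < pos b → load a b < k) →
                (A : AbelianGroup 0ℓ 0ℓ) → HasOrder A k → Σ _ λ f → IsTwinColoring A G f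
    colouring {k} room A order = Colouring.twinColouring k room′ extends A order (n * n + 0) key-bound
      where
      room′ : ∀ {a b} → Adj G a b → load a b < k
      room′ {a} {b} ab = case <-cmp (pos a) (pos b) of λ where
        (tri< a<b _ _) → room ab a<b
        (tri≈ _ a≡b _) → contradiction (pos-injective a≡b) (Adj⇒≢ ab)
        (tri> _ _ b<a) → subst (_< k) (load-sym b a) (room (Adj-sym ab) b<a)

    colouring-3≤c : 2 ≤ maxDegree G → 3 ≤ c → (A : AbelianGroup 0ℓ 0ℓ) →
                    HasOrder A (2 * (maxDegree G + c) ∸ 5) → Σ _ λ f → IsTwinColoring A G f
    colouring-3≤c 2≤Δ 3≤c = colouring (load-3≤c 2≤Δ 3≤c)

    colouring-forest : c ≡ 2 → 3 ≤ maxDegree G → (A : AbelianGroup 0ℓ 0ℓ) →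
                       HasOrder A (2 * (maxDegree G + c) ∸ 5) → Σ _ λ f → IsTwinColoring A G f
    colouring-forest c≡2 3≤Δ = colouring (load-forest c≡2 3≤Δ)

-- Consequences of connectedness and order at least three

third-vertex : ∀ {n} → 3 ≤ n → (u v : Fin n) → ∃ λ x → x ≢ u × x ≢ v
third-vertex (s≤s (s≤s (s≤s _))) zero          zero          = suc zero , (λ ()) , (λ ())
third-vertex (s≤s (s≤s (s≤s _))) zero          (suc zero)    = suc (suc zero) , (λ ()) , (λ ())
third-vertex (s≤s (s≤s (s≤s _))) zero          (suc (suc _)) = suc zero , (λ ()) , (λ ())
third-vertex (s≤s (s≤s (s≤s _))) (suc zero)    zero          = suc (suc zero) , (λ ()) , (λ ())
third-vertex (s≤s (s≤s (s≤s _))) (suc (suc _)) zero          = suc zero , (λ ()) , (λ ())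
third-vertex (s≤s (s≤s (s≤s _))) (suc _)       (suc _)       = zero , (λ ()) , (λ ())

module ConnectedGraph {n : ℕ} (G : Graph n) (3≤n : 3 ≤ n) (connected : Connected G) where
  open Adjacency G

  -- Connectedness enters only in this form: a nonempty set closed under adjacency, such as the
  -- vertices of a complete walk, is everything.
  closed⇒universal : {P : Pred (Fin n) 0ℓ} → (∀ {u v} → P u → Adj G u v → P v) →
                     ∀ {r} → P r → ∀ v → P v
  closed⇒universal {P} closed {r} Pr v = along (connected r v) Pr
    where
    along : ∀ {u v} → Star (Adj G) u v → P u → P v
    along stop        Pu = Pu
    along (uz ◅ walk) Pu = along walk (closed Pu uz)

  -- Otherwise `u` and `v` would form a closed set that misses a third vertex.
  extends : ∀ {u v} → Adj G u v → ∃ λ z → (Adj G u z × z ≢ v) ⊎ (Adj G v z × z ≢ u)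
  extends {u} {v} uv
    with Fin.any? (λ z → (adj? u z ×-dec ¬? (z Fin.≟ v)) ⊎-dec (adj? v z ×-dec ¬? (z Fin.≟ u)))
  ... | yes found = found
  ... | no none   = contradiction (closed⇒universal closed (inj₁ refl) x) [ x≢u , x≢v ]′
    where
    x = proj₁ (third-vertex 3≤n u v)
    x≢u = proj₁ (proj₂ (third-vertex 3≤n u v))
    x≢v = proj₂ (proj₂ (third-vertex 3≤n u v))
    closed : ∀ {y z} → y ≡ u ⊎ y ≡ v → Adj G y z → z ≡ u ⊎ z ≡ v
    closed {z = z} (inj₁ refl) uz with z Fin.≟ v
    ... | yes z≡v = inj₂ z≡v
    ... | no z≢v  = contradiction (z , inj₁ (uz , z≢v)) none
    closed {z = z} (inj₂ refl) vz with z Fin.≟ u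
    ... | yes z≡u = inj₁ z≡u
    ... | no z≢u  = contradiction (z , inj₂ (vz , z≢u)) none

  neighbour : ∀ v → ∃ (Adj G v)
  neighbour v with Fin.any? (adj? v)
  ... | yes found = found
  ... | no none   = contradiction
    (closed⇒universal {_≡ v} (λ { refl vz → contradiction (_ , vz) none }) refl _)
    (proj₁ (proj₂ (third-vertex 3≤n v v)))

  some-vertex : Fin n
  some-vertex = fromℕ< (≤-trans (s≤s z≤n) 3≤n)

  two-neighbours : ∀ {x y z} → Adj G x y → Adj G x z → z ≢ y → 2 ≤ maxDegree G
  two-neighbours {x} {y} xy xz z≢y = ≤-trans
    (≤-trans (s≤s (#-nonempty (adj? x without y) (xz , z≢y))) (#-without (adj? x) xy)) (#-adj≤Δ x)

  2≤Δ : 2 ≤ maxDegree G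
  2≤Δ with neighbour some-vertex
  ... | v , uv with extends uv
  ...   | z , inj₁ (uz , z≢v) = two-neighbours uv uz z≢v
  ...   | z , inj₂ (vz , z≢u) = two-neighbours (Adj-sym uv) vz z≢u

  -- The coloring property is applied to the whole graph. The vertex found yields `2 ≤ c` and, in
  -- the path case, the leaf to start from.
  ColProp⇒small-degree : ∀ {c} → ColProp G c → ∃ λ v → # (adj? v) < c
  ColProp⇒small-degree col with col whole (some-vertex , refl)
    where
    whole : Subgraph G
    whole = record { S = λ _ → true ; E = adj G ; E-sym = sym G ; E⊆G = λ _ _ uv → uv ; E⊆S = λ _ _ _ → refl }
  ... | v , _ , few = v , ≤-<-trans (≤-reflexive (#-adj v)) few

  2≤col : ∀ {c} → ColProp G c → 2 ≤ c
  2≤col col with ColProp⇒small-degree col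
  ... | v , few = ≤-trans (s≤s (#-nonempty (adj? v) (proj₂ (neighbour v)))) few

  -- Graphs of maximum degree two with a leaf are paths

  module Path (Δ≤2 : maxDegree G ≤ 2) (r : Fin n) (r-leaf : # (adj? r) ≤ 1) where

    -- A predicate instead of a function on indices, since index 0 has no predecessor.
    Prev : (ℕ → Fin n) → ℕ → Pred (Fin n) 0ℓ
    Prev p zero    z = ⊥
    Prev p (suc j) z = z ≡ p j

    prev? : ∀ p i → Decidable (Prev p i)
    prev? p zero    z = no λ ()
    prev? p (suc j) z = z Fin.≟ p j

    -- Only the values of `p` up to `m` matter. The field `inner` is what keeps the walk from
    -- closing into a cycle.
    record Walk (m : ℕ) : Set where
      field
        p         : ℕ → Fin n
        p-start   : p 0 ≡ r
        p-step    : ∀ {i} → i < m → Adj G (p i) (p (suc i))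
        p-inj     : ∀ {i j} → i ≤ m → j ≤ m → p i ≡ p j → i ≡ j
        inner     : ∀ {i z} → i < m → Adj G (p i) z → z ≡ p (suc i) ⊎ Prev p i z

    Complete : ∀ {m} → Walk m → Set
    Complete {m} W = ∀ {z} → Adj G (Walk.p W m) z → Prev (Walk.p W) m z

    single : Walk 0
    single = record
      { p = λ _ → r ; p-start = refl ; p-step = λ () ; p-inj = λ { z≤n z≤n _ → refl } ; inner = λ () }

    module _ {m : ℕ} (W : Walk m) where
      open Walk W

      m<n : m < n
      m<n with m <? n
      ... | yes lt = lt
      ... | no m≮n with Fin.pigeonhole {n = suc m} (s≤s (≮⇒≥ m≮n)) (λ i → p (toℕ i))
      ...   | i , j , i<j , eq = contradiction (p-inj (s≤s⁻¹ (Fin.toℕ<n i)) (s≤s⁻¹ (Fin.toℕ<n j)) eq) (<⇒≢ i<j)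

      prev-adj : ∀ {i z} → i ≤ m → Prev p i z → Adj G (p i) z
      prev-adj {suc j} i≤m refl = Adj-sym (p-step i≤m)

      module Longer {z : Fin n} (mz : Adj G (p m) z) (¬prev : ¬ Prev p m z) where

        p′ : ℕ → Fin n
        p′ i = if does (i ≤? m) then p i else z

        p′-old : ∀ {i} → i ≤ m → p′ i ≡ p i
        p′-old {i} i≤m rewrite dec-true (i ≤? m) i≤m = refl

        p′-new : p′ (suc m) ≡ z
        p′-new rewrite dec-false (suc m ≤? m) (<-irrefl refl) = refl

        -- If a neighbour of the last vertex occurred earlier on the walk, then by `inner` the two
        -- would be consecutive there, and the neighbour would be the predecessor.
        fresh : ∀ {i} → i ≤ m → p i ≢ z
        fresh {i} i≤m refl with m≤n⇒m<n∨m≡n i≤m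
        ... | inj₂ refl = Adj⇒≢ mz refl
        ... | inj₁ i<m with inner i<m (Adj-sym mz)
        ...   | inj₁ eq with refl ← p-inj ≤-refl i<m eq = ¬prev refl
        fresh {suc j} i≤m refl | inj₁ i<m | inj₂ eq =
          <⇒≢ (<-trans (n<1+n j) i<m) (≡.sym (p-inj ≤-refl (≤-trans (n≤1+n j) i≤m) eq))

        prev′ : ∀ {i x} → i ≤ suc m → Prev p i x → Prev p′ i x
        prev′ {suc i} (s≤s i≤m) eq = ≡.trans eq (≡.sym (p′-old i≤m))

        p′-step : ∀ {i} → i < suc m → Adj G (p′ i) (p′ (suc i))
        p′-step i<1+m with m≤n⇒m<n∨m≡n (s≤s⁻¹ i<1+m)
        ... | inj₁ i<m  = ≡.subst₂ (Adj G) (≡.sym (p′-old (<⇒≤ i<m))) (≡.sym (p′-old i<m)) (p-step i<m)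
        ... | inj₂ refl = ≡.subst₂ (Adj G) (≡.sym (p′-old ≤-refl)) (≡.sym p′-new) mz

        p′-inj : ∀ {i j} → i ≤ suc m → j ≤ suc m → p′ i ≡ p′ j → i ≡ j
        p′-inj i≤ j≤ eq with m≤n⇒m<n∨m≡n i≤ | m≤n⇒m<n∨m≡n j≤
        ... | inj₁ i<  | inj₁ j<  = p-inj (s≤s⁻¹ i<) (s≤s⁻¹ j<)
          (≡.trans (≡.sym (p′-old (s≤s⁻¹ i<))) (≡.trans eq (p′-old (s≤s⁻¹ j<))))
        ... | inj₁ i<  | inj₂ refl = contradiction
          (≡.trans (≡.sym (p′-old (s≤s⁻¹ i<))) (≡.trans eq p′-new)) (fresh (s≤s⁻¹ i<))
        ... | inj₂ refl | inj₁ j<  = contradiction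
          (≡.trans (≡.sym (p′-old (s≤s⁻¹ j<))) (≡.trans (≡.sym eq) p′-new)) (fresh (s≤s⁻¹ j<))
        ... | inj₂ refl | inj₂ refl = refl

        end : ∀ {x} → Adj G (p m) x → x ≡ z ⊎ Prev p m x
        -- The index is generalised so that matching can separate the start, which is the leaf `r`,
        -- from a vertex with a predecessor.
        end = at m refl
          where
          at : ∀ i → i ≡ m → ∀ {x} → Adj G (p m) x → x ≡ z ⊎ Prev p m x
          at zero    refl mx = inj₁ (#≤1⇒unique (adj? (p m))
            (subst (λ v → # (adj? v) ≤ 1) (≡.sym p-start) r-leaf) mx mz)
          at (suc j) refl mx = #≤2⇒one-of (adj? (p m)) (≤-trans (#-adj≤Δ (p m)) Δ≤2)
            mz (Adj-sym (p-step ≤-refl)) mx ¬prev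

        inner′ : ∀ {i x} → i < suc m → Adj G (p′ i) x → x ≡ p′ (suc i) ⊎ Prev p′ i x
        inner′ {x = x} i<1+m ix with m≤n⇒m<n∨m≡n (s≤s⁻¹ i<1+m)
        ... | inj₁ i<m with inner i<m (subst (λ v → Adj G v x) (p′-old (<⇒≤ i<m)) ix)
        ...   | inj₁ eq   = inj₁ (≡.trans eq (≡.sym (p′-old i<m)))
        ...   | inj₂ prev = inj₂ (prev′ (<⇒≤ i<1+m) prev)
        inner′ {x = x} i<1+m ix | inj₂ refl with end (subst (λ v → Adj G v x) (p′-old ≤-refl) ix)
        ...   | inj₁ eq   = inj₁ (≡.trans eq (≡.sym p′-new))
        ...   | inj₂ prev = inj₂ (prev′ (n≤1+n m) prev)

        longer : Walk (suc m)
        longer = record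
          { p = p′ ; p-start = ≡.trans (p′-old z≤n) p-start
          ; p-step = p′-step ; p-inj = p′-inj ; inner = inner′ }

      grow : Complete W ⊎ Walk (suc m)
      grow with Fin.any? (λ z → adj? (p m) z ×-dec ¬? (prev? p m z))
      ... | yes (z , mz , ¬prev) = inj₂ (Longer.longer mz ¬prev)
      ... | no none = inj₁ complete
        where
        complete : Complete W
        complete {z} mz with prev? p m z
        ... | yes prev = prev
        ... | no ¬prev = contradiction (z , mz , ¬prev) none

    -- Walks repeat no vertex and thus have fewer than `n` steps, so fuel `n` cannot run out before
    -- an extension fails.
    complete-walk : Σ ℕ λ m → Σ (Walk m) Complete
    complete-walk = search n 0 (m≤m+n n 0) single
      where
      search : ∀ fuel m → n ≤ fuel + m → Walk m → Σ ℕ λ m → Σ (Walk m) Complete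
      search zero       m n≤m W = contradiction n≤m (<⇒≱ (m<n W))
      search (suc fuel) m n≤  W with grow W
      ... | inj₁ complete = m , W , complete
      ... | inj₂ W′       = search fuel (suc m) (≤-trans n≤ (≤-reflexive (≡.sym (+-suc fuel m)))) W′

    -- Periodic labelling of a path

    module Labelled {m : ℕ} (walk : Walk m) (complete : Complete walk) where
      open Walk walk

      -- All neighbours of vertices of a complete walk lie on it, so its vertex set is closed.
      covered : ∀ v → ∃ λ i → i ≤ m × p i ≡ v
      covered = closed⇒universal closed (0 , z≤n , p-start)
        where
        closed : ∀ {u v} → (∃ λ i → i ≤ m × p i ≡ u) → Adj G u v → ∃ λ i → i ≤ m × p i ≡ v
        closed (i , i≤m , refl) uv with m≤n⇒m<n∨m≡n i≤m
        ... | inj₂ refl = back i i≤m (complete uv)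
          where
          back : ∀ {v} i → i ≤ m → Prev p i v → ∃ λ i → i ≤ m × p i ≡ v
          back (suc j) i≤m eq = j , ≤-trans (n≤1+n j) i≤m , ≡.sym eq
        ... | inj₁ i<m with inner i<m uv
        ...   | inj₁ eq = suc i , i<m , ≡.sym eq
        closed (suc j , i≤m , refl) uv | inj₁ _ | inj₂ eq = j , ≤-trans (n≤1+n j) i≤m , ≡.sym eq

      pos : Fin n → ℕ
      pos v = proj₁ (covered v)

      pos≤m : ∀ v → pos v ≤ m
      pos≤m v = proj₁ (proj₂ (covered v))

      p-pos : ∀ v → p (pos v) ≡ v
      p-pos v = proj₂ (proj₂ (covered v))

      pos-p : ∀ {i} → i ≤ m → pos (p i) ≡ i
      pos-p {i} i≤m = p-inj (pos≤m (p i)) i≤m (p-pos (p i))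

      2≤m : 2 ≤ m
      2≤m with 2 ≤? m | third-vertex 3≤n (p 0) (p 1)
      ... | yes 2≤m | _ = 2≤m
      ... | no 2≰m  | x , x≢p0 , x≢p1 with covered x
      ...   | zero        , _   , eq = contradiction (≡.sym eq) x≢p0
      ...   | suc zero    , _   , eq = contradiction (≡.sym eq) x≢p1
      ...   | suc (suc i) , i≤m , _  = contradiction (≤-trans (s≤s (s≤s z≤n)) i≤m) 2≰m

      Adj-p⇒ : ∀ {i z} → i ≤ m → Adj G (p i) z → (i < m × z ≡ p (suc i)) ⊎ Prev p i z
      Adj-p⇒ i≤m iz with m≤n⇒m<n∨m≡n i≤m
      ... | inj₂ refl = inj₂ (complete iz)
      ... | inj₁ i<m with inner i<m iz
      ...   | inj₁ eq   = inj₁ (i<m , eq)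
      ...   | inj₂ prev = inj₂ prev

      Adj⇒consecutive : ∀ {u v} → Adj G u v → pos v ≡ suc (pos u) ⊎ pos u ≡ suc (pos v)
      Adj⇒consecutive {u} {v} uv with pos u | pos≤m u | p-pos u
      ... | i | i≤m | refl with Adj-p⇒ i≤m uv
      ...   | inj₁ (i<m , refl) = inj₁ (pos-p i<m)
      Adj⇒consecutive uv | suc j | i≤m | refl | inj₂ refl = inj₂ (cong suc (≡.sym (pos-p (≤-trans (n≤1+n j) i≤m))))

      pos-injective : ∀ {u v} → pos u ≡ pos v → u ≡ v
      pos-injective {u} {v} eq = ≡.trans (≡.sym (p-pos u)) (≡.trans (cong p eq) (p-pos v))

      module _ {k : ℕ} (3≤k : 3 ≤ k) (A : AbelianGroup 0ℓ 0ℓ) (order : HasOrder A k) where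
        open AbelianGroup A renaming (refl to ≈-refl; sym to ≈-sym; trans to ≈-trans)
        open import Algebra.Properties.AbelianGroup A using (∙-cancelˡ)
        open FiniteOrder A k order

        cycle : Carrier → Carrier → Carrier → ℕ → Carrier
        cycle x y z zero    = x
        cycle x y z (suc i) = cycle y z x i

        cycle-≉₁ : ∀ {x y z} → ¬ x ≈ y → ¬ y ≈ z → ¬ z ≈ x → ∀ i → ¬ cycle x y z i ≈ cycle x y z (suc i)
        cycle-≉₁ xy yz zx zero    = xy
        cycle-≉₁ xy yz zx (suc i) = cycle-≉₁ yz zx xy i

        cycle-≉₂ : ∀ {x y z} → ¬ x ≈ y → ¬ y ≈ z → ¬ z ≈ x → ∀ i → ¬ cycle x y z i ≈ cycle x y z (2 + i)
        cycle-≉₂ xy yz zx zero    = zx ∘ ≈-sym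
        cycle-≉₂ xy yz zx (suc i) = cycle-≉₂ yz zx xy i

        -- `π i` is meant for the edge from `p i` to `p (suc i)`. `π-≉₁` gives properness. For the
        -- weights, `π-≉₂` handles adjacent vertices inside the path, `π-1` the first pair and
        -- `π-m∸2` the last pair.
        record Labels : Set where
          field
            π     : ℕ → Carrier
            π-≉₁  : ∀ i → ¬ π i ≈ π (suc i)
            π-≉₂  : ∀ i → ¬ π i ≈ π (2 + i)
            π-1   : ¬ π 1 ≈ ε
            π-m∸2 : ¬ π (m ∸ 2) ≈ ε

        labels : Labels
        labels with avoid (ε ∷ []) (<⇒≤ 3≤k)
        ... | b , b≉ε ∷ [] with avoid (ε ∷ b ∷ []) 3≤k
        ...   | c , c≉ε ∷ c≉b ∷ [] with cycle ε b c (m ∸ 2) ≈? ε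
        ...     | no ≉ε = record
          { π = cycle ε b c
          ; π-≉₁ = cycle-≉₁ (b≉ε ∘ ≈-sym) (c≉b ∘ ≈-sym) c≉ε
          ; π-≉₂ = cycle-≉₂ (b≉ε ∘ ≈-sym) (c≉b ∘ ≈-sym) c≉ε
          ; π-1 = b≉ε
          ; π-m∸2 = ≉ε
          }
        -- Shifting the cycle by one replaces the entry `ε` at `m ∸ 2` by its successor, which
        -- differs from it, and puts `c` at index 1.
        ...     | yes ≈ε = record
          { π = cycle b c ε
          ; π-≉₁ = cycle-≉₁ (c≉b ∘ ≈-sym) c≉ε (b≉ε ∘ ≈-sym)
          ; π-≉₂ = cycle-≉₂ (c≉b ∘ ≈-sym) c≉ε (b≉ε ∘ ≈-sym)
          ; π-1 = c≉ε
          ; π-m∸2 = λ eq → cycle-≉₁ (b≉ε ∘ ≈-sym) (c≉b ∘ ≈-sym) c≉ε (m ∸ 2) (≈-trans ≈ε (≈-sym eq))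
          }

        open Labels labels

        f : Fin n → Fin n → Carrier
        f u v = π (pos u ⊓ pos v)

        f-sym : ∀ u v → f u v ≈ f v u
        f-sym u v = reflexive (cong π (⊓-comm (pos u) (pos v)))

        f-suc : ∀ {u v} → pos v ≡ suc (pos u) → f u v ≈ π (pos u)
        f-suc {u} eq = reflexive (cong π (m≤n⇒m⊓n≡m (≤-trans (n≤1+n (pos u)) (≤-reflexive (≡.sym eq)))))

        f-proper : ∀ v u u′ → Adj G v u → Adj G v u′ → u ≢ u′ → ¬ f v u ≈ f v u′
        f-proper v u u′ vu vu′ u≢u′ eq with Adj⇒consecutive vu | Adj⇒consecutive vu′
        ... | inj₁ s | inj₁ s′ = u≢u′ (pos-injective (≡.trans s (≡.sym s′)))
        ... | inj₂ s | inj₂ s′ = u≢u′ (pos-injective (suc-injective (≡.trans (≡.sym s) s′)))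
        ... | inj₁ s | inj₂ s′ = π-≉₁ (pos u′) (≈-trans (≈-sym (≈-trans (f-sym v u′) (f-suc s′)))
          (≈-trans (≈-sym eq) (≈-trans (f-suc s) (reflexive (cong π s′)))))
        ... | inj₂ s | inj₁ s′ = π-≉₁ (pos u) (≈-trans (≈-sym (≈-trans (f-sym v u) (f-suc s)))
          (≈-trans eq (≈-trans (f-suc s′) (reflexive (cong π s)))))

        -- Labels of the two edges at `p i`, with `ε` for the missing edge at either end of the
        -- path.
        left right : ℕ → Carrier
        left zero    = ε
        left (suc j) = π j
        right i = if does (i <? m) then π i else ε

        right-inner : ∀ {i} → i < m → right i ≈ π i
        right-inner {i} i<m rewrite dec-true (i <? m) i<m = ≈-refl

        right-end : right m ≈ ε
        right-end rewrite dec-false (m <? m) (<-irrefl refl) = ≈-refl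

        term : ℕ → Fin n → Carrier
        term i z = if adj G (p i) z then f (p i) z else ε

        -- Isolates the summand of the predecessor; `gsum-update` then adds the one of the
        -- successor.
        prevTerm : ℕ → Fin n → Carrier
        prevTerm i z = if does (prev? p i z) then left i else ε

        gsum-prevTerm : ∀ {i} → gsum A (prevTerm i) ≈ left i
        gsum-prevTerm {zero}  = gsum-ε A {n} (λ _ → ≈-refl)
        gsum-prevTerm {suc j} = ≈-trans (gsum-update A {F = λ _ → ε} (p j) at off)
          (≈-trans (∙-congʳ (gsum-ε A {n} (λ _ → ≈-refl))) (identityˡ (π j)))
          where
          at : prevTerm (suc j) (p j) ≈ ε ∙ π j
          at rewrite dec-true (p j Fin.≟ p j) refl = ≈-sym (identityˡ (π j))
          off : ∀ z → z ≢ p j → prevTerm (suc j) z ≈ ε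
          off z z≢ rewrite dec-false (z Fin.≟ p j) z≢ = ≈-refl

        term-next : ∀ {i} → i < m → term i (p (suc i)) ≈ π i
        term-next {i} i<m rewrite p-step i<m = ≈-trans
          (f-suc (≡.trans (pos-p i<m) (cong suc (≡.sym (pos-p (<⇒≤ i<m))))))
          (reflexive (cong π (pos-p (<⇒≤ i<m))))

        next-not-prev : ∀ {i} → i < m → ¬ Prev p i (p (suc i))
        next-not-prev {suc j} i<m eq = <⇒≢ (<-trans (n<1+n j) (n<1+n (suc j)))
          (≡.sym (p-inj i<m (≤-trans (n≤1+n j) (<⇒≤ i<m)) eq))

        prevTerm-next : ∀ {i} → i < m → prevTerm i (p (suc i)) ≈ ε
        prevTerm-next {i} i<m rewrite dec-false (prev? p i (p (suc i))) (next-not-prev i<m) = ≈-refl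

        term-prev : ∀ {i z} → i ≤ m → (Adj G (p i) z → Prev p i z) → term i z ≈ prevTerm i z
        term-prev {i} {z} i≤m only with prev? p i z
        ... | no ¬prev rewrite Bool.¬-not (¬prev ∘ only) = ≈-refl
        term-prev {suc j} {z} i≤m only | yes refl rewrite prev-adj walk {suc j} i≤m refl =
          ≈-trans (f-sym (p (suc j)) (p j)) (≈-trans
            (f-suc (≡.trans (pos-p i≤m) (cong suc (≡.sym (pos-p (≤-trans (n≤1+n j) i≤m))))))
            (reflexive (cong π (pos-p (≤-trans (n≤1+n j) i≤m)))))

        weight-p : ∀ {i} → i ≤ m → weight A G f (p i) ≈ left i ∙ right i
        weight-p {i} i≤m with m≤n⇒m<n∨m≡n i≤m
        ... | inj₁ i<m = ≈-trans
          (gsum-update A {F = prevTerm i} (p (suc i))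
            (≈-trans (term-next i<m) (≈-sym (≈-trans (∙-congʳ (prevTerm-next i<m)) (identityˡ (π i)))))
            (λ z z≢ → term-prev i≤m λ iz → case Adj-p⇒ i≤m iz of λ where
              (inj₁ (_ , eq)) → contradiction eq z≢
              (inj₂ prev) → prev))
          (∙-cong (gsum-prevTerm {i}) (≈-sym (right-inner i<m)))
        ... | inj₂ refl = ≈-trans (gsum-cong A {n} {term m} {prevTerm m} (λ z → term-prev i≤m complete))
          (≈-trans (gsum-prevTerm {m}) (≈-sym (≈-trans (∙-congˡ right-end) (identityʳ (left m)))))

        -- This is what remains of comparing the weights of `p i` and `p (suc i)` after cancelling
        -- the label of the edge between them.
        left≉right : ∀ {i} → suc i ≤ m → ¬ left i ≈ right (suc i)
        left≉right {zero}  _   eq = π-1 (≈-trans (≈-sym (right-inner 2≤m)) (≈-sym eq))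
        left≉right {suc j} i≤m eq with m≤n⇒m<n∨m≡n i≤m
        ... | inj₁ i<m = π-≉₂ j (≈-trans eq (right-inner i<m))
        -- Here `j` equals `m ∸ 2`, and the last vertex has no edge on its right.
        ... | inj₂ i≡m = π-m∸2 (≈-trans (reflexive (cong (λ l → π (l ∸ 2)) (≡.sym i≡m)))
          (≈-trans eq (≈-trans (reflexive (cong right i≡m)) right-end)))

        twin-step : ∀ {u v} → pos v ≡ suc (pos u) → ¬ weight A G f u ≈ weight A G f v
        twin-step {u} {v} s eq = left≉right u<m (∙-cancelˡ (π (pos u)) _ _
          (≈-trans (comm (π (pos u)) (left (pos u)))
          (≈-trans (∙-congˡ (≈-sym (right-inner u<m)))
          (≈-trans (≈-sym (weight-p (pos≤m u)))
          (≈-trans (reflexive (cong (weight A G f) (p-pos u)))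
          (≈-trans eq
          (≈-trans (reflexive (cong (weight A G f) (≡.trans (≡.sym (p-pos v)) (cong p s))))
          (weight-p u<m))))))))
          where
          u<m : suc (pos u) ≤ m
          u<m = subst (_≤ m) s (pos≤m v)

        labelled : Σ _ λ f → IsTwinColoring A G f
        labelled = f , (λ u v _ → f-sym u v) , f-proper , λ u v uv → case Adj⇒consecutive uv of λ where
          (inj₁ s) → twin-step s
          (inj₂ s) → twin-step s ∘ ≈-sym

    twinColouring : ∀ {k} → 3 ≤ k → (A : AbelianGroup 0ℓ 0ℓ) → HasOrder A k → Σ _ λ f → IsTwinColoring A G f
    twinColouring with complete-walk
    ... | _ , walk , complete = Labelled.labelled walk complete

-- Choice of the colouring according to coloring number and maximum degree

theorem5 : ∀ (n : ℕ) (G : Graph n) → 3 ≤ n → Connected G →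
    ∀ (c : ℕ) → IsColoringNumber G c →
    GroupTwinIndexAtMost G (2 * (maxDegree G + c) ∸ 5)
theorem5 n G 3≤n connected c (col , _) = k , (<⇒≤ 3≤k , admissible) , ≤-refl
  where
  open Adjacency G
  open ConnectedGraph G 3≤n connected
  open Degeneracy G

  k = 2 * (maxDegree G + c) ∸ 5

  3≤k : 3 ≤ k
  -- Maximum degree and `c` are both at least 2, and 2(2 + 2) - 5 = 3.
  3≤k = ∸-monoˡ-≤ 5 (*-monoʳ-≤ 2 (+-mono-≤ 2≤Δ (2≤col col)))

  degeneracyOrder : DegeneracyOrder c
  degeneracyOrder = ColProp⇒order (2≤col col) col

  admissible : (A : AbelianGroup 0ℓ 0ℓ) → HasOrder A k → Σ _ λ f → IsTwinColoring A G f
  admissible = case (3 ≤? c) of λ where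
    (yes 3≤c) → Room.colouring-3≤c G degeneracyOrder extends 2≤Δ 3≤c
    (no c<3) → case (3 ≤? maxDegree G) of λ where
      (yes 3≤Δ) → Room.colouring-forest G degeneracyOrder extends (≤-antisym (s≤s⁻¹ (≰⇒> c<3)) (2≤col col)) 3≤Δ
      -- Since `c ≤ 2`, the vertex of degree below `c` is a leaf and can start the path.
      (no Δ<3) → let r , few = ColProp⇒small-degree col in
        Path.twinColouring (s≤s⁻¹ (≰⇒> Δ<3)) r (s≤s⁻¹ (≤-trans few (s≤s⁻¹ (≰⇒> c<3)))) 3≤k
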